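{- Given a WF net $M$, the following statements are equivalent: (i) The application of the net-based AND-OR reduction to $M$ results in a one-node WF net. (ii) The application of the class-based AND-OR reduction to $M$ results in a class of one-node WF nets. (iii) $M$ can be reduced to a one-node WF net by zero or more AND-OR contractions, i.e. $M\leadsto^*M'$ for some one-node WF net $M'$.
   Context: **Nets.** A Petri net is a tuple $(P,T,F)$ with $P$ (places) and $T$ (transitions) finite disjoint sets and $F\subseteq (T\times P)\cup(P\times T)$ (edges). Elements of $P\cup T$ are nodes; the type of a node is "place" or "transition". For a node $a$: $\bullet a=\{b\mid (b,a)\in F\}$, $a\bullet=\{b\mid (a,b)\in F\}$. An I/O net is $N=(P,T,F,I,O)$ with $(P,T,F)$ a Petri net and $I,O\subseteq P\cup T$ non-empty (input nodes and output nodes). It is I/O consistent if $I\cup O\subseteq P$ or $I\cup O\subseteq T$. It is well-connected if every node is reachable by a directed path (possibly a single node) from some node of $I$, and from every node some node of $O$ is reachable. A WF net is an I/O net that is I/O consistent and well-connected; it is a pWF net if $I\cup O\subseteq P$ and a tWF net if $I\cup O\subseteq T$. Node names come from an infinite supply. **Subnets.** A subnet of a WF net $M=(P_M,T_M,F_M,I_M,O_M)$ is a non-empty set $S\subseteq P_M\cup T_M$; it is trivial if $|S|=1$. Its associated net is $M[S]=(P_S,T_S,F_S,I_S,O_S)$ with $P_S=P_M\cap S$, $T_S=T_M\cap S$, $F_S=F_M\cap(S\times S)$, $I_S=(I_M\cap S)\cup\{n_2\in S\mid \exists n_1\in (P_M\cup T_M)\setminus S: (n_1,n_2)\in F_M\}$,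 $O_S=(O_M\cap S)\cup\{n_1\in S\mid \exists n_2\in (P_M\cup T_M)\setminus S: (n_1,n_2)\in F_M\}$. **Contraction.** If $M[S]$ is a pWF net (resp. tWF net), the result of contracting $S$ in $M$ into a new place (resp. transition) $n\notin P_M\cup T_M$ is $M'=(P_{M'},T_{M'},F_{M'},I_{M'},O_{M'})$, where $P_{M'}=(P_M\setminus S)\cup\{n\}$, $T_{M'}=T_M\setminus S$ (resp. $P_{M'}=P_M\setminus S$, $T_{M'}=(T_M\setminus S)\cup\{n\}$); $F_{M'}=\{(n_1,n_2)\in F_M\mid n_1,n_2\notin S\}\cup\{(n_1,n)\mid (n_1,n_2)\in F_M,n_1\notin S,n_2\in I_S\}\cup\{(n,n_2)\mid (n_1,n_2)\in F_M,n_1\in O_S,n_2\notin S\}$; $I_{M'}=I_M$ if $S\cap I_M=\emptyset$ and $(I_M\setminus S)\cup\{n\}$ otherwise; $O_{M'}=O_M$ if $S\cap O_M=\emptyset$ and $(O_M\setminus S)\cup\{n\}$ otherwise. **Well-nestedness.** $S$ is well-nested in $M$ if for all $n_1,n_2\in I_S$: for every $n_3\notin S$, $(n_3,n_2)\in F_M$ implies $(n_3,n_1)\in F_M$, and $n_2\in I_M$ implies $n_1\in I_M$; and for all $n_1,n_2\in O_S$: for every $n_3\notin S$, $(n_2,n_3)\in F_M$ implies $(n_1,n_3)\in F_M$, and $n_2\in O_M$ implies $n_1\in O_M$. **Basic AND-OR classes.** A WF net $(P,T,F,I,O)$ has the AND property if for every $p\in P$: ($p\in I$ and $|\bullet p|=0$,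 or $p\notin I$ and $|\bullet p|=1$) and ($p\in O$ and $|p\bullet|=0$, or $p\notin O$ and $|p\bullet|=1$). It has the OR property if the same holds with every transition $t\in T$ in the role of $p$. An AND net is an acyclic WF net with the AND property; an OR net is a WF net with the OR property. The basic AND-OR classes are: pAND (AND nets that are pWF nets), 11tAND (AND nets that are tWF nets with $|I|=|O|=1$), 11pOR (OR nets that are pWF nets with $|I|=|O|=1$), tOR (OR nets that are tWF nets). **AND-OR contraction relation.** $S$ is AND-OR contractible in $M$ if $S$ is well-nested in $M$ and $M[S]$ is a WF net belonging to a basic AND-OR class. $M\leadsto M'$ means that some AND-OR contractible subnet of $M$ (possibly trivial) can be contracted with result $M'$; $\leadsto^*$ is the reflexive transitive closure. **Isomorphism, classes and reductions.** $M\sim M'$ means there is a bijection $h:P_M\cup T_M\to P_{M'}\cup T_{M'}$ with $P_{M'}=h(P_M)$, $T_{M'}=h(T_M)$, $F_{M'}=\{(h(n_1),h(n_2))\mid (n_1,n_2)\in F_M\}$, $I_{M'}=h(I_M)$, $O_{M'}=h(O_M)$. $[M]$ is the class of WF nets isomorphic to $M$. $[M]\Rightarrow[M']$ iff $[M]\ne[M']$ and there are $M_1\in[M]$, $M_2\in[M']$ with $M_1\leadsto M_2$; $\Rightarrow^*$ is its reflexive transitive closure. $[M']$ is a result of the class-based AND-OR reduction of $M$ if $[M]\Rightarrow^*[M']$ and there is no WF net $M''$ with $[M']\Rightarrow[M'']$. $M'$ is a result of the net-based AND-OR reduction of $M$ if $M$ can be reduced to $M'$ by a finite (possibly empty) sequence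 of contractions of non-trivial AND-OR contractible subnets and there is no non-trivial AND-OR contractible subnet in $M'$. -}

module Defs where

open import Data.Bool.Base using (if_then_else_)
open import Data.Nat.Base using (ℕ)
open import Data.Nat.Properties using (_≟_)
open import Data.List.Base using (List; []; _∷_; _++_; map; filter; length; deduplicate)
open import Data.List.Membership.Propositional using (_∈_; _∉_)
open import Data.List.Membership.DecPropositional _≟_ using (_∈?_; _∉?_)
open import Data.List.Relation.Binary.BagAndSetEquality using (_∼[_]_; set)
open import Data.List.Relation.Binary.Disjoint.Propositional using (Disjoint)
open import Data.List.Relation.Binary.Subset.Propositional using (_⊆_)
open import Data.List.Relation.Unary.Any using (any?)
open import Data.Product.Base using (_×_; _,_; proj₁; proj₂; ∃; ∃-syntax; ∃₂)
open import Data.Product.Properties using (≡-dec)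
open import Data.Sum.Base using (_⊎_)
open import Level using (0ℓ)
open import Relation.Binary.Construct.Closure.ReflexiveTransitive using (Star)
open import Relation.Binary.Construct.Closure.Transitive using (TransClosure)
open import Relation.Binary.PropositionalEquality using (_≡_; _≢_)
open import Relation.Nullary.Decidable using (does; _×-dec_)
open import Relation.Nullary.Negation using (¬_)
open import Relation.Unary using (Pred; _≐_)

import Data.List.Membership.DecPropositional (≡-dec _≟_ _≟_) as Edges

-- ℕ is the infinite supply of node names.  A finite set is given by a list
-- in which order and multiplicity are irrelevant: sets are compared with
-- _∼[ set ]_, and ∣_∣ counts distinct elements.

Node : Set
Node = ℕ

Edge : Set
Edge = Node × Node

∣_∣ : List Node → ℕ
∣ xs ∣ = length (deduplicate _≟_ xs)

infixl 6 _∖_ _∩_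

_∖_ _∩_ : List Node → List Node → List Node
xs ∖ ys = filter (_∉? ys) xs
xs ∩ ys = filter (_∈? ys) xs

record Net : Set where
  field
    P T : List Node
    F   : List Edge
    I O : List Node

  nodes : List Node
  nodes = P ++ T

  _⟶_ : Node → Node → Set
  a ⟶ b = (a , b) ∈ F

  pre post : Node → List Node
  pre  a = map proj₁ (filter (λ e → proj₂ e ≟ a) F)
  post a = map proj₂ (filter (λ e → proj₁ e ≟ a) F)

open Net using (nodes)

record IsPetriNet (N : Net) : Set where
  open Net N hiding (nodes)
  field
    disjoint  : Disjoint P T
    bipartite : ∀ {a b} → a ⟶ b → (a ∈ T × b ∈ P) ⊎ (a ∈ P × b ∈ T)

record IsIONet (N : Net) : Set where
  open Net N hiding (nodes)
  field
    isPetriNet : IsPetriNet N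
    I⊆nodes    : I ⊆ nodes N
    O⊆nodes    : O ⊆ nodes N
    I≢∅        : I ≢ []
    O≢∅        : O ≢ []

data NodeType : Set where
  place transition : NodeType

nodesOfType : NodeType → Net → List Node
nodesOfType place      = Net.P
nodesOfType transition = Net.T

IOWithin : NodeType → Net → Set
IOWithin τ N = (Net.I N ++ Net.O N) ⊆ nodesOfType τ N

IOConsistent : Net → Set
IOConsistent N = IOWithin place N ⊎ IOWithin transition N

record WellConnected (N : Net) : Set where
  open Net N hiding (nodes)
  field
    fromInput : ∀ {x} → x ∈ nodes N → ∃[ i ] i ∈ I × Star _⟶_ i x
    toOutput  : ∀ {x} → x ∈ nodes N → ∃[ o ] o ∈ O × Star _⟶_ x o

record IsWF (N : Net) : Set where
  field
    isIONet       : IsIONet N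
    ioConsistent  : IOConsistent N
    wellConnected : WellConnected N

-- pWF nets for τ = place, tWF nets for τ = transition.
IsτWF : NodeType → Net → Set
IsτWF τ N = IsWF N × IOWithin τ N

record WFNet : Set where
  field
    net  : Net
    isWF : IsWF net

open WFNet using (net)

IsOneNode : Pred WFNet 0ℓ
IsOneNode M = ∣ nodes (net M) ∣ ≡ 1

record IsSubnet (M : Net) (S : List Node) : Set where
  field
    nonEmpty : S ≢ []
    S⊆nodes  : S ⊆ nodes M

IsTrivial : List Node → Set
IsTrivial S = ∣ S ∣ ≡ 1

infix 8 _⟦_⟧

_⟦_⟧ : Net → List Node → Net
M ⟦ S ⟧ = record
  { P = P ∩ S
  ; T = T ∩ S
  ; F = filter (λ e → (proj₁ e ∈? S) ×-dec (proj₂ e ∈? S)) F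
  ; I = (I ∩ S) ++ filter (λ n₂ → any? (λ n₁ → (n₁ , n₂) Edges.∈? F) (nodes M ∖ S)) S
  ; O = (O ∩ S) ++ filter (λ n₁ → any? (λ n₂ → (n₁ , n₂) Edges.∈? F) (nodes M ∖ S)) S
  }
  where open Net M hiding (nodes)

addIf : NodeType → NodeType → Node → List Node → List Node
addIf place      place      n xs = n ∷ xs
addIf transition transition n xs = n ∷ xs
addIf _          _          n xs = xs

contract : NodeType → Net → List Node → Node → Net
contract τ M S n = record
  { P = addIf τ place      n (P ∖ S)
  ; T = addIf τ transition n (T ∖ S)
  ; F = filter (λ e → (proj₁ e ∉? S) ×-dec (proj₂ e ∉? S)) F
     ++ map (λ e → proj₁ e , n) (filter (λ e → (proj₁ e ∉? S) ×-dec (proj₂ e ∈? Iₛ)) F)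
     ++ map (λ e → n , proj₂ e) (filter (λ e → (proj₁ e ∈? Oₛ) ×-dec (proj₂ e ∉? S)) F)
  ; I = replace I
  ; O = replace O
  }
  where
  open Net M hiding (nodes)
  Iₛ = Net.I (M ⟦ S ⟧)
  Oₛ = Net.O (M ⟦ S ⟧)

  replace : List Node → List Node
  replace xs = if does (any? (_∈? xs) S) then n ∷ (xs ∖ S) else xs

infix 4 _≈_

record _≈_ (N N′ : Net) : Set where
  private
    module N  = Net N
    module N′ = Net N′
  field
    P-≈ : N.P ∼[ set ] N′.P
    T-≈ : N.T ∼[ set ] N′.T
    F-≈ : N.F ∼[ set ] N′.F
    I-≈ : N.I ∼[ set ] N′.I
    O-≈ : N.O ∼[ set ] N′.O

ContractsTo : Net → List Node → Net → Set
ContractsTo M S M′ =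
  ∃₂ λ τ n → IsτWF τ (M ⟦ S ⟧) × n ∉ nodes M × M′ ≈ contract τ M S n

record WellNested (M : Net) (S : List Node) : Set where
  open Net M
  Iₛ = Net.I (M ⟦ S ⟧)
  Oₛ = Net.O (M ⟦ S ⟧)
  field
    inputs  : ∀ {n₁ n₂} → n₁ ∈ Iₛ → n₂ ∈ Iₛ →
              (∀ {n₃} → n₃ ∉ S → n₃ ⟶ n₂ → n₃ ⟶ n₁) × (n₂ ∈ I → n₁ ∈ I)
    outputs : ∀ {n₁ n₂} → n₁ ∈ Oₛ → n₂ ∈ Oₛ →
              (∀ {n₃} → n₃ ∉ S → n₂ ⟶ n₃ → n₁ ⟶ n₃) × (n₂ ∈ O → n₁ ∈ O)

-- The AND property for τ = place, the OR property for τ = transition.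
DegreeProperty : NodeType → Net → Set
DegreeProperty τ N = ∀ {x} → x ∈ nodesOfType τ N →
    ((x ∈ I × ∣ pre  x ∣ ≡ 0) ⊎ (x ∉ I × ∣ pre  x ∣ ≡ 1))
  × ((x ∈ O × ∣ post x ∣ ≡ 0) ⊎ (x ∉ O × ∣ post x ∣ ≡ 1))
  where open Net N

Acyclic : Net → Set
Acyclic N = ∀ {x} → ¬ TransClosure (Net._⟶_ N) x x

IsAND IsOR : Net → Set
IsAND N = IsWF N × Acyclic N × DegreeProperty place N
IsOR  N = IsWF N × DegreeProperty transition N

SingleIO : Net → Set
SingleIO N = ∣ Net.I N ∣ ≡ 1 × ∣ Net.O N ∣ ≡ 1

data BasicANDOR (N : Net) : Set where
  pAND   : IsAND N → IsτWF place N                   → BasicANDOR N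
  11tAND : IsAND N → IsτWF transition N → SingleIO N → BasicANDOR N
  11pOR  : IsOR N  → IsτWF place N → SingleIO N      → BasicANDOR N
  tOR    : IsOR N  → IsτWF transition N              → BasicANDOR N

record ANDORContractible (M : WFNet) (S : List Node) : Set where
  field
    isSubnet   : IsSubnet (net M) S
    wellNested : WellNested (net M) S
    basic      : BasicANDOR (net M ⟦ S ⟧)

infix 4 _⇝_ _⇝*_ _⇝ⁿᵗ_ _~_ _⇒_ _⇒*_

_⇝_ _⇝*_ : WFNet → WFNet → Set
M ⇝ M′ = ∃[ S ] ANDORContractible M S × ContractsTo (net M) S (net M′)
_⇝*_ = Star _⇝_

_⇝ⁿᵗ_ : WFNet → WFNet → Set
M ⇝ⁿᵗ M′ = ∃[ S ] ¬ IsTrivial S × ANDORContractible M S × ContractsTo (net M) S (net M′)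

NetBasedResult : WFNet → WFNet → Set
NetBasedResult M M′ =
  Star _⇝ⁿᵗ_ M M′ × ¬ (∃[ S ] ¬ IsTrivial S × ANDORContractible M′ S)

-- The bijection is the restriction of h to the nodes of M; that it is onto
-- the nodes of M′ follows from P-image and T-image.
record _~_ (M M′ : WFNet) : Set where
  private
    module M  = Net (net M)
    module M′ = Net (net M′)
  field
    h         : Node → Node
    injective : ∀ {x y} → x ∈ M.nodes → y ∈ M.nodes → h x ≡ h y → x ≡ y
    P-image   : M′.P ∼[ set ] map h M.P
    T-image   : M′.T ∼[ set ] map h M.T
    F-image   : M′.F ∼[ set ] map (λ e → h (proj₁ e) , h (proj₂ e)) M.F
    I-image   : M′.I ∼[ set ] map h M.I
    O-image   : M′.O ∼[ set ] map h M.O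

[_] : WFNet → Pred WFNet 0ℓ
[ M ] = M ~_

-- Relations on isomorphism classes, written on representatives:
-- M ⇒ M′ stands for [M] ⇒ [M′], and equality of classes is [ M ] ≐ [ M′ ].
_⇒_ : WFNet → WFNet → Set
M ⇒ M′ = ¬ ([ M ] ≐ [ M′ ]) × ∃₂ λ M₁ M₂ → [ M ] M₁ × [ M′ ] M₂ × M₁ ⇝ M₂

data _⇒*_ : WFNet → WFNet → Set where
  done : ∀ {M M′} → [ M ] ≐ [ M′ ] → M ⇒* M′
  step : ∀ {M M′ M″} → M ⇒ M′ → M′ ⇒* M″ → M ⇒* M″

ClassBasedResult : WFNet → WFNet → Set
ClassBasedResult M M′ = M ⇒* M′ × ¬ (∃[ M″ ] M′ ⇒ M″)

{-# OPTIONS --safe #-}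
-- Contracting a trivial subnet only renames a node, and contracting a
-- non-trivial one strictly decreases the number of nodes.  Contractions can be
-- transported along isomorphisms, so in any of the three kinds of reduction the
-- renaming steps can be absorbed into the isomorphism relating the current
-- nets.  A one-node net is normal for both reductions since its only subnets
-- are trivial; as each of (i)-(iii) only asks for some successful reduction, no
-- confluence argument is needed.

module Submission where

open import Defs
open import Data.Product.Base using (_×_; ∃-syntax)
open import Function.Bundles using (_⇔_)
open import Relation.Unary using (_⊆_)

open import Data.Bool.Base using (true; false; if_then_else_)
open import Data.Empty using (⊥-elim)
open import Data.List.Base using (List; []; _∷_; _++_; map; filter; length; deduplicate)
open import Data.List.Membership.Propositional using (_∈_; _∉_; find; lose)
open import Data.List.Membership.Propositional.Properties
  using (∈-filter⁺; ∈-filter⁻; ∈-map⁺; ∈-map⁻; ∈-++⁺ˡ; ∈-++⁺ʳ; ∈-++⁻;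
         ∈-deduplicate⁺; ∈-deduplicate⁻)
open import Data.List.Membership.Propositional.Properties.WithK using (unique∧set⇒bag)
open import Data.List.Properties using (length-map; length-++; filter-++)
open import Data.List.Relation.Binary.BagAndSetEquality using (_∼[_]_; set; ∼bag⇒↭)
open import Data.List.Relation.Binary.Permutation.Propositional using (↭-sym)
open import Data.List.Relation.Binary.Permutation.Propositional.Properties
  using (↭-length; ∈-resp-↭; shift)
open import Data.List.Relation.Unary.All.Properties using (¬Any⇒All¬)
open import Data.List.Relation.Unary.Any using (Any; here; there; any?)
open import Data.List.Relation.Unary.Unique.Propositional using (Unique; _∷_)
open import Data.Nat.Base using (suc; _+_)
open import Data.Nat.Properties using (_≟_; +-suc; +-comm; +-cancelˡ-≡; suc-injective)
open import Data.Product.Base using (_,_; proj₁; proj₂; ∃₂)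
open import Data.Product.Function.NonDependent.Propositional using (_×-⇔_; _×-↔_)
open import Data.Sum.Base as Sum using (_⊎_)
open import Function.Base using (_∘_; id)
open import Function.Bundles using (_↔_; mk⇔; mk↔ₛ′; Equivalence; Inverse)
open import Function.Properties.Inverse using (↔-refl; ↔-sym; ↔-trans)
open import Function.Related.TypeIsomorphisms using (¬-cong-⇔)
open import Relation.Binary.Construct.Closure.ReflexiveTransitive using (Star; ε; _◅_; gmap)
open import Relation.Binary.Construct.Closure.Transitive as Plus using (TransClosure)
open import Relation.Binary.PropositionalEquality
  using (_≡_; _≢_; refl; sym; trans; cong; cong₂; subst; subst₂; module ≡-Reasoning)
open import Relation.Nullary.Decidable using (Dec; yes; no; does; does-⇔; _×-dec_)
open import Relation.Nullary.Negation using (¬_; contradiction)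
open import Relation.Unary using (Pred; Decidable; _≐_)
open import Level using (0ℓ)

import Data.List.Membership.DecPropositional _≟_ as Nodes
import Data.List.Relation.Unary.Unique.DecPropositional.Properties _≟_ as Dedup
import Data.List.Relation.Unary.Unique.Propositional.Properties as Unique

open Equivalence using (to; from)
open Inverse using (strictlyInverseˡ; strictlyInverseʳ)
  renaming (to to infixl 20 _⟨$⟩ʳ_; from to infixl 20 _⟨$⟩ˡ_)
open Net using (nodes)
open WFNet using (net; isWF)

private variable
  A B C D : Set
  xs ys zs xs′ ys′ : List A

-- Finite sets as lists, transported along bijections.

↔-injective : (π : A ↔ B) → ∀ {x y} → π ⟨$⟩ʳ x ≡ π ⟨$⟩ʳ y → x ≡ y
↔-injective π {x} {y} eq =
  trans (sym (strictlyInverseʳ π x)) (trans (cong (π ⟨$⟩ˡ_) eq) (strictlyInverseʳ π y))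

infix 4 _≋[_]_

-- As `π` is a bijection of the whole types, this equivalence makes `ys` the image of `xs` as a set,
-- whatever the order and multiplicity of the entries.
record _≋[_]_ {A B : Set} (xs : List A) (π : A ↔ B) (ys : List B) : Set where
  constructor mk≋
  field
    ∈⇔ : ∀ {x} → x ∈ xs ⇔ π ⟨$⟩ʳ x ∈ ys

  push : ∀ {x} → x ∈ xs → π ⟨$⟩ʳ x ∈ ys
  push = to ∈⇔

  pull : ∀ {x} → π ⟨$⟩ʳ x ∈ ys → x ∈ xs
  pull = from ∈⇔

open _≋[_]_

≋-intro : (π : A ↔ B) →
          (∀ {x} → x ∈ xs → π ⟨$⟩ʳ x ∈ ys) → (∀ {y} → y ∈ ys → π ⟨$⟩ˡ y ∈ xs) → xs ≋[ π ] ys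
≋-intro π f g = mk≋ (λ {x} → mk⇔ f (λ y∈ → subst (_∈ _) (strictlyInverseʳ π x) (g y∈)))

≋-sym : (π : A ↔ B) → xs ≋[ π ] ys → ys ≋[ ↔-sym π ] xs
≋-sym π e = ≋-intro (↔-sym π)
  (λ {y} y∈ → pull e (subst (_∈ _) (sym (strictlyInverseˡ π y)) y∈)) (push e)

≋-trans : (π : A ↔ B) (ρ : B ↔ C) → xs ≋[ π ] ys → ys ≋[ ρ ] zs → xs ≋[ ↔-trans π ρ ] zs
≋-trans π ρ e f = mk≋ (mk⇔ (push f ∘ push e) (pull e ∘ pull f))

≋-map : (π : A ↔ B) → xs ≋[ π ] map (π ⟨$⟩ʳ_) xs
≋-map π = mk≋ (mk⇔ (∈-map⁺ (π ⟨$⟩ʳ_)) λ y∈ →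
  let _ , x∈ , eq = ∈-map⁻ (π ⟨$⟩ʳ_) y∈ in subst (_∈ _) (sym (↔-injective π eq)) x∈)

++-≋ : (π : A ↔ B) → xs ≋[ π ] ys → xs′ ≋[ π ] ys′ → xs ++ xs′ ≋[ π ] ys ++ ys′
++-≋ {xs = xs} {ys = ys} π e f = mk≋ (mk⇔
  (Sum.[ ∈-++⁺ˡ ∘ push e , ∈-++⁺ʳ ys ∘ push f ] ∘ ∈-++⁻ xs)
  (Sum.[ ∈-++⁺ˡ ∘ pull e , ∈-++⁺ʳ xs ∘ pull f ] ∘ ∈-++⁻ ys))

∷-≋ : (π : A ↔ B) (x : A) → xs ≋[ π ] ys → x ∷ xs ≋[ π ] (π ⟨$⟩ʳ x) ∷ ys
∷-≋ π x e = ++-≋ π (≋-map {xs = x ∷ []} π) e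

filter-≋ : (π : A ↔ B) {P : Pred A 0ℓ} {Q : Pred B 0ℓ} {P? : Decidable P} {Q? : Decidable Q} →
           (∀ x → P x ⇔ Q (π ⟨$⟩ʳ x)) → xs ≋[ π ] ys → filter P? xs ≋[ π ] filter Q? ys
filter-≋ π {P? = P?} {Q?} P⇔Q e = mk≋ (mk⇔
  (λ x∈ → let x∈xs , px = ∈-filter⁻ P? x∈ in ∈-filter⁺ Q? (push e x∈xs) (to (P⇔Q _) px))
  (λ y∈ → let y∈ys , qy = ∈-filter⁻ Q? y∈ in ∈-filter⁺ P? (pull e y∈ys) (from (P⇔Q _) qy)))

map-≋ : (π : A ↔ B) (ρ : C ↔ D) {f : A → C} {g : B → D} →
        (∀ x → ρ ⟨$⟩ʳ f x ≡ g (π ⟨$⟩ʳ x)) → xs ≋[ π ] ys → map f xs ≋[ ρ ] map g ys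
map-≋ π ρ {f} {g} comm e = ≋-intro ρ
  (λ x∈ → let a , a∈ , eq = ∈-map⁻ f x∈
          in subst (_∈ _) (sym (trans (cong (ρ ⟨$⟩ʳ_) eq) (comm a))) (∈-map⁺ g (push e a∈)))
  (λ y∈ → let b , b∈ , eq = ∈-map⁻ g y∈
          in subst (_∈ _) (↔-injective ρ (begin
               ρ ⟨$⟩ʳ f (π ⟨$⟩ˡ b)     ≡⟨ comm _ ⟩
               g (π ⟨$⟩ʳ (π ⟨$⟩ˡ b))   ≡⟨ cong g (strictlyInverseˡ π b) ⟩
               g b                     ≡⟨ sym eq ⟩
               _                       ≡⟨ sym (strictlyInverseˡ ρ _) ⟩
               ρ ⟨$⟩ʳ (ρ ⟨$⟩ˡ _)       ∎))
             (∈-map⁺ f (push (≋-sym π e) b∈)))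
  where open ≡-Reasoning

Any-≋ : (π : A ↔ B) {P : Pred A 0ℓ} {Q : Pred B 0ℓ} →
        (∀ x → P x ⇔ Q (π ⟨$⟩ʳ x)) → xs ≋[ π ] ys → Any P xs ⇔ Any Q ys
Any-≋ π {Q = Q} P⇔Q e = mk⇔
  (λ p → let _ , x∈ , px = find p in lose (push e x∈) (to (P⇔Q _) px))
  (λ q → let y , y∈ , qy = find q
         in lose (push (≋-sym π e) y∈)
              (from (P⇔Q _) (subst Q (sym (strictlyInverseˡ π y)) qy)))

≢[]-≋ : (π : A ↔ B) → xs ≋[ π ] ys → ys ≢ [] → xs ≢ []
≢[]-≋ {ys = []}    π e ys≢[] refl = ys≢[] refl
≢[]-≋ {ys = _ ∷ _} π e _     refl with () ← push (≋-sym π e) (here refl)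

-- Agreement is asked for on `xs` only, because a permutation extending the `h` of a given `_~_`
-- matches it just on the nodes.
image-≋ : (π : A ↔ B) {f : A → B} → (∀ {x} → x ∈ xs → π ⟨$⟩ʳ x ≡ f x) →
          ys ∼[ set ] map f xs → xs ≋[ π ] ys
image-≋ π {f} π≗f e = ≋-intro π
  (λ x∈ → subst (_∈ _) (sym (π≗f x∈)) (from e (∈-map⁺ f x∈)))
  (λ y∈ → let x , x∈ , eq = ∈-map⁻ f (to e y∈)
          in subst (_∈ _) (↔-injective π (trans (trans (π≗f x∈) (sym eq)) (sym (strictlyInverseˡ π _)))) x∈)

set-map-≋ : (π : A ↔ B) → xs ≋[ π ] ys → ys ∼[ set ] map (π ⟨$⟩ʳ_) xs
set-map-≋ π e {y} = mk⇔
  (λ y∈ → subst (_∈ _) (strictlyInverseˡ π y) (∈-map⁺ (π ⟨$⟩ʳ_) (push (≋-sym π e) y∈)))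
  (λ y∈ → let x , x∈ , eq = ∈-map⁻ (π ⟨$⟩ʳ_) y∈ in subst (_∈ _) (sym eq) (push e x∈))

-- Counting distinct elements.

-- Duplicate-free lists with the same members are permutations of each other. The counts for images,
-- complements and `_∷_` below each come from exhibiting a suitable `us`.
∣∣-unique : ∀ {us xs : List Node} → Unique us → us ∼[ set ] xs → length us ≡ ∣ xs ∣
∣∣-unique {us} {xs} us! e = ↭-length (∼bag⇒↭ (unique∧set⇒bag us! (Dedup.deduplicate-! xs)
  (mk⇔ (∈-deduplicate⁺ _≟_ ∘ to e) (from e ∘ ∈-deduplicate⁻ _≟_ xs))))

∣∣-≋ : ∀ {xs ys : List Node} π → xs ≋[ π ] ys → ∣ xs ∣ ≡ ∣ ys ∣
∣∣-≋ {xs} {ys} π e = trans (sym (length-map (π ⟨$⟩ʳ_) (deduplicate _≟_ xs)))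
  (∣∣-unique (Unique.map⁺ (↔-injective π) (Dedup.deduplicate-! xs)) (λ {y} → mk⇔
    (λ y∈ → let x , x∈ , eq = ∈-map⁻ (π ⟨$⟩ʳ_) y∈
            in subst (_∈ ys) (sym eq) (push e (∈-deduplicate⁻ _≟_ xs x∈)))
    (λ y∈ → subst (_∈ _) (strictlyInverseˡ π y)
       (∈-map⁺ (π ⟨$⟩ʳ_) (∈-deduplicate⁺ _≟_ (push (≋-sym π e) y∈))))))

-- The deduplicated lists of `xs ∖ ys` and `ys` share no entry, so their concatenation is a
-- duplicate-free listing of `xs`.
∣∖∣+∣∣ : ∀ {xs ys : List Node} → (∀ {x} → x ∈ ys → x ∈ xs) → ∣ xs ∖ ys ∣ + ∣ ys ∣ ≡ ∣ xs ∣
∣∖∣+∣∣ {xs} {ys} ys⊆xs = trans (sym (length-++ (deduplicate _≟_ (xs ∖ ys))))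
  (∣∣-unique
    (Unique.++⁺ (Dedup.deduplicate-! (xs ∖ ys)) (Dedup.deduplicate-! ys)
      (λ (l , r) → proj₂ (∈-filter⁻ (Nodes._∉? ys) {xs = xs} (∈-deduplicate⁻ _≟_ (xs ∖ ys) l))
                     (∈-deduplicate⁻ _≟_ ys r)))
    (mk⇔ (Sum.[ (λ l → proj₁ (∈-filter⁻ (Nodes._∉? ys) (∈-deduplicate⁻ _≟_ (xs ∖ ys) l)))
             , (λ r → ys⊆xs (∈-deduplicate⁻ _≟_ ys r)) ] ∘ ∈-++⁻ _)
         back))
  where
  back : ∀ {x} → x ∈ xs → x ∈ deduplicate _≟_ (xs ∖ ys) ++ deduplicate _≟_ ys
  back {x} x∈ with x Nodes.∈? ys
  ... | yes x∈ys = ∈-++⁺ʳ _ (∈-deduplicate⁺ _≟_ x∈ys)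
  ... | no  x∉ys = ∈-++⁺ˡ (∈-deduplicate⁺ _≟_ (∈-filter⁺ (Nodes._∉? ys) x∈ x∉ys))

∣∷∣ : ∀ {x : Node} {xs} → x ∉ xs → ∣ x ∷ xs ∣ ≡ suc ∣ xs ∣
∣∷∣ {x} {xs} x∉ = sym (∣∣-unique {us = x ∷ deduplicate _≟_ xs}
  (¬Any⇒All¬ _ (x∉ ∘ ∈-deduplicate⁻ _≟_ xs) ∷ Dedup.deduplicate-! xs)
  (mk⇔ (λ { (here eq) → here eq ; (there y∈) → there (∈-deduplicate⁻ _≟_ xs y∈) })
       (λ { (here eq) → here eq ; (there y∈) → there (∈-deduplicate⁺ _≟_ y∈) })))

≢[]⇒∣∣≢0 : ∀ {xs} → xs ≢ [] → ∣ xs ∣ ≢ 0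
≢[]⇒∣∣≢0 {[]}    xs≢[] _ = xs≢[] refl

∣∣≡1⇒singleton : ∀ {xs} → ∣ xs ∣ ≡ 1 → ∃[ x ] x ∈ xs × (∀ {y} → y ∈ xs → y ≡ x)
∣∣≡1⇒singleton {xs} eq with deduplicate _≟_ xs in dedup
... | x ∷ [] = x , ∈-deduplicate⁻ _≟_ xs (subst (x ∈_) (sym dedup) (here refl)) , only
  where
  only : ∀ {y} → y ∈ xs → y ≡ x
  only {y} y∈ with here y≡x ← subst (y ∈_) dedup (∈-deduplicate⁺ _≟_ y∈) = y≡x
... | []          with () ← eq
... | _ ∷ _ ∷ _ with () ← eq

-- Transpositions and permutations of node names.

transpose : Node → Node → Node → Node
transpose a b c with c ≟ a | c ≟ b
... | yes _ | _     = b
... | no _  | yes _ = a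
... | no _  | no _  = c

transpose-left : ∀ a b → transpose a b a ≡ b
transpose-left a b with a ≟ a | a ≟ b
... | yes _  | _ = refl
... | no a≢a | _ = contradiction refl a≢a

transpose-right : ∀ a b → transpose a b b ≡ a
transpose-right a b with b ≟ a | b ≟ b
... | yes refl | _      = refl
... | no _     | yes _  = refl
... | no _     | no b≢b = contradiction refl b≢b

transpose-other : ∀ {a b c} → c ≢ a → c ≢ b → transpose a b c ≡ c
transpose-other {a} {b} {c} c≢a c≢b with c ≟ a | c ≟ b
... | yes c≡a | _       = contradiction c≡a c≢a
... | no _    | yes c≡b = contradiction c≡b c≢b
... | no _    | no _    = refl

transpose-involutive : ∀ a b c → transpose a b (transpose a b c) ≡ c
transpose-involutive a b c = go (c ≟ a) (c ≟ b)
  where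
  go : Dec (c ≡ a) → Dec (c ≡ b) → transpose a b (transpose a b c) ≡ c
  go (yes refl) _          = trans (cong (transpose a b) (transpose-left a b)) (transpose-right a b)
  go (no _)     (yes refl) = trans (cong (transpose a b) (transpose-right a b)) (transpose-left a b)
  go (no c≢a)   (no c≢b)   =
    trans (cong (transpose a b) (transpose-other c≢a c≢b)) (transpose-other c≢a c≢b)

transposition : Node → Node → Node ↔ Node
transposition a b = mk↔ₛ′ (transpose a b) (transpose a b)
  (transpose-involutive a b) (transpose-involutive a b)

-- This lets isomorphisms of nets be permutations of the whole name supply,
-- which also name the new node of a transported contraction.
extendToPermutation : (h : Node → Node) (xs : List Node) →
  (∀ {x y} → x ∈ xs → y ∈ xs → h x ≡ h y → x ≡ y) →
  ∃[ π ] (∀ {x} → x ∈ xs → π ⟨$⟩ʳ x ≡ h x)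
extendToPermutation h []       inj = ↔-refl , λ ()
extendToPermutation h (x ∷ xs) inj
  with extendToPermutation h xs (λ y∈ z∈ → inj (there y∈) (there z∈)) | x Nodes.∈? xs
... | π , agree | yes x∈xs = π , λ { (here refl) → agree x∈xs ; (there y∈) → agree y∈ }
-- Swapping `π x` with `h x` corrects the value at `x` and leaves each `y` in `xs` alone: `π y`
-- differs from `π x` as `π` is injective, and `π y = h y` differs from `h x` as `h` is injective on
-- the list.
... | π , agree | no  x∉xs = ↔-trans π (transposition (π ⟨$⟩ʳ x) (h x)) , λ
  { (here refl) → transpose-left (π ⟨$⟩ʳ x) (h x)
  ; (there y∈)  → trans
      (transpose-other
        (λ eq → x∉xs (subst (_∈ xs) (↔-injective π eq) y∈))
        (λ eq → x∉xs (subst (_∈ xs) (inj (there y∈) (here refl) (trans (sym (agree y∈)) eq)) y∈)))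
      (agree y∈)
  }

-- Isomorphisms of nets along a permutation of the names.

edges : Node ↔ Node → Edge ↔ Edge
edges π = π ×-↔ π

infix 4 _≅[_]_

record _≅[_]_ (M : Net) (π : Node ↔ Node) (N : Net) : Set where
  private
    module M = Net M
    module N = Net N
  field
    P-≋ : M.P ≋[ π ] N.P
    T-≋ : M.T ≋[ π ] N.T
    F-≋ : M.F ≋[ edges π ] N.F
    I-≋ : M.I ≋[ π ] N.I
    O-≋ : M.O ≋[ π ] N.O

  nodes-≋ : nodes M ≋[ π ] nodes N
  nodes-≋ = ++-≋ π P-≋ T-≋

  type-≋ : ∀ τ → nodesOfType τ M ≋[ π ] nodesOfType τ N
  type-≋ place      = P-≋
  type-≋ transition = T-≋

  pre-≋ : ∀ x → M.pre x ≋[ π ] N.pre (π ⟨$⟩ʳ x)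
  pre-≋ x = map-≋ (edges π) π (λ _ → refl)
    (filter-≋ (edges π) (λ _ → mk⇔ (cong (π ⟨$⟩ʳ_)) (↔-injective π)) F-≋)

  post-≋ : ∀ x → M.post x ≋[ π ] N.post (π ⟨$⟩ʳ x)
  post-≋ x = map-≋ (edges π) π (λ _ → refl)
    (filter-≋ (edges π) (λ _ → mk⇔ (cong (π ⟨$⟩ʳ_)) (↔-injective π)) F-≋)

open _≅[_]_

≅-sym : ∀ {M N} π → M ≅[ π ] N → N ≅[ ↔-sym π ] M
≅-sym π φ = record
  { P-≋ = ≋-sym π (P-≋ φ)
  ; T-≋ = ≋-sym π (T-≋ φ)
  -- Repacked because the index changes from `↔-sym (edges π)` to `edges (↔-sym π)`; the forward
  -- maps of the two compute to the same function, and `∈⇔` mentions nothing else.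
  ; F-≋ = mk≋ (∈⇔ (≋-sym (edges π) (F-≋ φ)))
  ; I-≋ = ≋-sym π (I-≋ φ)
  ; O-≋ = ≋-sym π (O-≋ φ)
  }

≅-trans : ∀ {L M N} π ρ → L ≅[ π ] M → M ≅[ ρ ] N → L ≅[ ↔-trans π ρ ] N
≅-trans π ρ φ ψ = record
  { P-≋ = ≋-trans π ρ (P-≋ φ) (P-≋ ψ)
  ; T-≋ = ≋-trans π ρ (T-≋ φ) (T-≋ ψ)
  ; F-≋ = mk≋ (∈⇔ (≋-trans (edges π) (edges ρ) (F-≋ φ) (F-≋ ψ)))
  ; I-≋ = ≋-trans π ρ (I-≋ φ) (I-≋ ψ)
  ; O-≋ = ≋-trans π ρ (O-≋ φ) (O-≋ ψ)
  }

≈⇒≅ : ∀ {M N} → M ≈ N → M ≅[ ↔-refl ] N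
≈⇒≅ e = record
  { P-≋ = mk≋ (_≈_.P-≈ e)
  ; T-≋ = mk≋ (_≈_.T-≈ e)
  ; F-≋ = mk≋ (_≈_.F-≈ e)
  ; I-≋ = mk≋ (_≈_.I-≈ e)
  ; O-≋ = mk≋ (_≈_.O-≈ e)
  }

≈-refl : ∀ {M} → M ≈ M
≈-refl = record
  { P-≈ = mk⇔ id id ; T-≈ = mk⇔ id id ; F-≈ = mk⇔ id id ; I-≈ = mk⇔ id id ; O-≈ = mk⇔ id id }

-- Invariance of net properties, pulled back from `N` to `M`.

module _ {M N : Net} (π : Node ↔ Node) (φ : M ≅[ π ] N) where

  IsPetriNet-≅ : IsPetriNet N → IsPetriNet M
  IsPetriNet-≅ petri = record
    { disjoint  = λ (x∈P , x∈T) → disjoint (push (P-≋ φ) x∈P , push (T-≋ φ) x∈T)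
    ; bipartite = λ a⟶b → Sum.map
        (λ (a∈ , b∈) → pull (T-≋ φ) a∈ , pull (P-≋ φ) b∈)
        (λ (a∈ , b∈) → pull (P-≋ φ) a∈ , pull (T-≋ φ) b∈)
        (bipartite (push (F-≋ φ) a⟶b))
    }
    where open IsPetriNet petri

  IsIONet-≅ : IsIONet N → IsIONet M
  IsIONet-≅ io = record
    { isPetriNet = IsPetriNet-≅ isPetriNet
    ; I⊆nodes    = λ x∈ → pull (nodes-≋ φ) (I⊆nodes (push (I-≋ φ) x∈))
    ; O⊆nodes    = λ x∈ → pull (nodes-≋ φ) (O⊆nodes (push (O-≋ φ) x∈))
    ; I≢∅        = ≢[]-≋ π (I-≋ φ) I≢∅
    ; O≢∅        = ≢[]-≋ π (O-≋ φ) O≢∅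
    }
    where open IsIONet io

  IOWithin-≅ : ∀ τ → IOWithin τ N → IOWithin τ M
  IOWithin-≅ τ io x∈ = pull (type-≋ φ τ) (io (push (++-≋ π (I-≋ φ) (O-≋ φ)) x∈))

  WellConnected-≅ : WellConnected N → WellConnected M
  WellConnected-≅ wc = record
    { fromInput = λ {x} x∈ → let i , i∈ , path = fromInput (push (nodes-≋ φ) x∈) in
        π ⟨$⟩ˡ i , push (I-≋ ψ) i∈ ,
        subst (Star _ (π ⟨$⟩ˡ i)) (strictlyInverseʳ π x) (gmap (π ⟨$⟩ˡ_) (push (F-≋ ψ)) path)
    ; toOutput  = λ {x} x∈ → let o , o∈ , path = toOutput (push (nodes-≋ φ) x∈) in
        π ⟨$⟩ˡ o , push (O-≋ ψ) o∈ ,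
        subst (λ y → Star _ y (π ⟨$⟩ˡ o)) (strictlyInverseʳ π x) (gmap (π ⟨$⟩ˡ_) (push (F-≋ ψ)) path)
    }
    where
    open WellConnected wc
    ψ : N ≅[ ↔-sym π ] M
    ψ = ≅-sym π φ

  IsWF-≅ : IsWF N → IsWF M
  IsWF-≅ wf = record
    { isIONet       = IsIONet-≅ isIONet
    ; ioConsistent  = Sum.map (IOWithin-≅ place) (IOWithin-≅ transition) ioConsistent
    ; wellConnected = WellConnected-≅ wellConnected
    }
    where open IsWF wf

  IsτWF-≅ : ∀ τ → IsτWF τ N → IsτWF τ M
  IsτWF-≅ τ (wf , io) = IsWF-≅ wf , IOWithin-≅ τ io

  Acyclic-≅ : Acyclic N → Acyclic M
  Acyclic-≅ acyclic = acyclic ∘ push⁺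
    where
    push⁺ : ∀ {x y} → TransClosure (Net._⟶_ M) x y →
            TransClosure (Net._⟶_ N) (π ⟨$⟩ʳ x) (π ⟨$⟩ʳ y)
    push⁺ Plus.[ x⟶y ]    = Plus.[ push (F-≋ φ) x⟶y ]
    push⁺ (x⟶y Plus.∷ p) = push (F-≋ φ) x⟶y Plus.∷ push⁺ p

  DegreeProperty-≅ : ∀ τ → DegreeProperty τ N → DegreeProperty τ M
  DegreeProperty-≅ τ degree {x} x∈ =
    let ins , outs = degree (push (type-≋ φ τ) x∈) in
    pullDegree (I-≋ φ) (pre-≋ φ x) ins , pullDegree (O-≋ φ) (post-≋ φ x) outs
    where
    pullDegree : ∀ {xs ys us vs : List Node} → xs ≋[ π ] ys → us ≋[ π ] vs →
      (π ⟨$⟩ʳ x ∈ ys × ∣ vs ∣ ≡ 0) ⊎ (π ⟨$⟩ʳ x ∉ ys × ∣ vs ∣ ≡ 1) →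
      (x ∈ xs × ∣ us ∣ ≡ 0) ⊎ (x ∉ xs × ∣ us ∣ ≡ 1)
    pullDegree e f = Sum.map
      (λ (x∈ , eq) → pull e x∈ , trans (∣∣-≋ π f) eq)
      (λ (x∉ , eq) → x∉ ∘ push e , trans (∣∣-≋ π f) eq)

  IsAND-≅ : IsAND N → IsAND M
  IsAND-≅ (wf , acyclic , degree) =
    IsWF-≅ wf , Acyclic-≅ acyclic , DegreeProperty-≅ place degree

  IsOR-≅ : IsOR N → IsOR M
  IsOR-≅ (wf , degree) = IsWF-≅ wf , DegreeProperty-≅ transition degree

  SingleIO-≅ : SingleIO N → SingleIO M
  SingleIO-≅ (i , o) = trans (∣∣-≋ π (I-≋ φ)) i , trans (∣∣-≋ π (O-≋ φ)) o

  BasicANDOR-≅ : BasicANDOR N → BasicANDOR M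
  BasicANDOR-≅ (pAND and wf)        = pAND (IsAND-≅ and) (IsτWF-≅ place wf)
  BasicANDOR-≅ (11tAND and wf s)    = 11tAND (IsAND-≅ and) (IsτWF-≅ transition wf) (SingleIO-≅ s)
  BasicANDOR-≅ (11pOR or wf s)      = 11pOR (IsOR-≅ or) (IsτWF-≅ place wf) (SingleIO-≅ s)
  BasicANDOR-≅ (tOR or wf)          = tOR (IsOR-≅ or) (IsτWF-≅ transition wf)

  -- Transport of subnets and contractions.

  module _ {S S′ : List Node} (σ : S ≋[ π ] S′) where

    ∈-S-⇔ : ∀ x → x ∈ S ⇔ π ⟨$⟩ʳ x ∈ S′
    ∈-S-⇔ x = ∈⇔ σ

    ∉-S-⇔ : ∀ x → x ∉ S ⇔ π ⟨$⟩ʳ x ∉ S′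
    ∉-S-⇔ x = ¬-cong-⇔ (∈⇔ σ)

    ∖-≋ : ∀ {xs ys} → xs ≋[ π ] ys → xs ∖ S ≋[ π ] ys ∖ S′
    ∖-≋ = filter-≋ π ∉-S-⇔

    ∩-≋ : ∀ {xs ys} → xs ≋[ π ] ys → xs ∩ S ≋[ π ] ys ∩ S′
    ∩-≋ = filter-≋ π ∈-S-⇔

    subnet-≅ : M ⟦ S ⟧ ≅[ π ] N ⟦ S′ ⟧
    subnet-≅ = record
      { P-≋ = ∩-≋ (P-≋ φ)
      ; T-≋ = ∩-≋ (T-≋ φ)
      ; F-≋ = filter-≋ (edges π) (λ (a , b) → ∈-S-⇔ a ×-⇔ ∈-S-⇔ b) (F-≋ φ)
      ; I-≋ = ++-≋ π (∩-≋ (I-≋ φ))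
          (filter-≋ π (λ _ → Any-≋ π (λ _ → ∈⇔ (F-≋ φ)) (∖-≋ (nodes-≋ φ))) σ)
      ; O-≋ = ++-≋ π (∩-≋ (O-≋ φ))
          (filter-≋ π (λ _ → Any-≋ π (λ _ → ∈⇔ (F-≋ φ)) (∖-≋ (nodes-≋ φ))) σ)
      }

    replace-≋ : ∀ n {xs ys} → xs ≋[ π ] ys →
      (if does (any? (Nodes._∈? xs) S) then n ∷ (xs ∖ S) else xs)
      ≋[ π ]
      (if does (any? (Nodes._∈? ys) S′) then (π ⟨$⟩ʳ n) ∷ (ys ∖ S′) else ys)
    replace-≋ n {xs} {ys} e
      -- Both tests ask whether the subnet meets the list, so they yield the same Boolean and a
      -- single case split settles both sides.
      rewrite does-⇔ (Any-≋ π (λ _ → ∈⇔ e) σ) (any? (Nodes._∈? xs) S) (any? (Nodes._∈? ys) S′)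
      with does (any? (Nodes._∈? ys) S′)
    ... | true  = ∷-≋ π n (∖-≋ e)
    ... | false = e

    contract-≅ : ∀ τ n → contract τ M S n ≅[ π ] contract τ N S′ (π ⟨$⟩ʳ n)
    contract-≅ τ n = record
      { P-≋ = P′ τ
      ; T-≋ = T′ τ
      ; F-≋ = ++-≋ (edges π)
          (filter-≋ (edges π) (λ (a , b) → ∉-S-⇔ a ×-⇔ ∉-S-⇔ b) (F-≋ φ))
          (++-≋ (edges π)
            (map-≋ (edges π) (edges π) (λ _ → refl)
              (filter-≋ (edges π) (λ (a , b) → ∉-S-⇔ a ×-⇔ ∈⇔ (I-≋ subnet-≅)) (F-≋ φ)))
            (map-≋ (edges π) (edges π) (λ _ → refl)
              (filter-≋ (edges π) (λ (a , b) → ∈⇔ (O-≋ subnet-≅) ×-⇔ ∉-S-⇔ b) (F-≋ φ))))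
      ; I-≋ = replace-≋ n (I-≋ φ)
      ; O-≋ = replace-≋ n (O-≋ φ)
      }
      where
      -- `addIf` computes only once the node type is a constructor, hence the split on `τ`.
      P′ : ∀ τ → Net.P (contract τ M S n) ≋[ π ] Net.P (contract τ N S′ (π ⟨$⟩ʳ n))
      P′ place      = ∷-≋ π n (∖-≋ (P-≋ φ))
      P′ transition = ∖-≋ (P-≋ φ)

      T′ : ∀ τ → Net.T (contract τ M S n) ≋[ π ] Net.T (contract τ N S′ (π ⟨$⟩ʳ n))
      T′ place      = ∖-≋ (T-≋ φ)
      T′ transition = ∷-≋ π n (∖-≋ (T-≋ φ))

    WellNested-≅ : WellNested N S′ → WellNested M S
    WellNested-≅ nested = record
      { inputs  = λ n₁∈ n₂∈ →
          let edge , input = inputs (push (I-≋ subnet-≅) n₁∈) (push (I-≋ subnet-≅) n₂∈) in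
          (λ n₃∉ n₃⟶n₂ → pull (F-≋ φ) (edge (to (∉-S-⇔ _) n₃∉) (push (F-≋ φ) n₃⟶n₂))) ,
          pull (I-≋ φ) ∘ input ∘ push (I-≋ φ)
      ; outputs = λ n₁∈ n₂∈ →
          let edge , output = outputs (push (O-≋ subnet-≅) n₁∈) (push (O-≋ subnet-≅) n₂∈) in
          (λ n₃∉ n₂⟶n₃ → pull (F-≋ φ) (edge (to (∉-S-⇔ _) n₃∉) (push (F-≋ φ) n₂⟶n₃))) ,
          pull (O-≋ φ) ∘ output ∘ push (O-≋ φ)
      }
      where open WellNested nested using (inputs; outputs)

    IsSubnet-≅ : IsSubnet N S′ → IsSubnet M S
    IsSubnet-≅ sub = record
      { nonEmpty = ≢[]-≋ π σ nonEmpty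
      ; S⊆nodes  = λ x∈ → pull (nodes-≋ φ) (S⊆nodes (push σ x∈))
      }
      where open IsSubnet sub

-- Contraction of a one-node subnet as a renaming.

edge⇒nodes : ∀ {N} → IsPetriNet N → ∀ {a b} → (a , b) ∈ Net.F N → a ∈ nodes N × b ∈ nodes N
edge⇒nodes {N} petri a⟶b = Sum.[ (λ (a∈T , b∈P) → ∈-++⁺ʳ P a∈T , ∈-++⁺ˡ b∈P)
                               , (λ (a∈P , b∈T) → ∈-++⁺ˡ a∈P , ∈-++⁺ʳ P b∈T) ]
                               (IsPetriNet.bipartite petri a⟶b)
  where open Net N using (P)

module _ {x n : Node} {S : List Node} (x∈S : x ∈ S) (only-x : ∀ {y} → y ∈ S → y ≡ x) where

  private
    σ : Node ↔ Node
    σ = transposition x n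

    ∉S⇒≢x : ∀ {y} → y ∉ S → y ≢ x
    ∉S⇒≢x y∉S y≡x = y∉S (subst (_∈ S) (sym y≡x) x∈S)

    ∈∧∉⇒≢ : ∀ {a b} {zs : List Node} → a ∈ zs → b ∉ zs → a ≢ b
    ∈∧∉⇒≢ a∈ b∉ a≡b = b∉ (subst (_∈ _) a≡b a∈)

    fixed : ∀ {y zs} → y ∉ S → y ∈ zs → n ∉ zs → transpose x n y ≡ y
    fixed y∉S y∈ n∉ = transpose-other (∉S⇒≢x y∉S) (∈∧∉⇒≢ y∈ n∉)

    -- Removing `S` takes away just `x`, and the transposition sends `x` to the fresh `n` while
    -- fixing the remaining entries.
    transposed-∈ : ∀ {xs} → x ∈ xs → n ∉ xs → xs ≋[ σ ] n ∷ (xs ∖ S)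
    transposed-∈ {xs} x∈ n∉ = ≋-intro σ forward backward
      where
      forward : ∀ {y} → y ∈ xs → transpose x n y ∈ n ∷ (xs ∖ S)
      forward {y} y∈ with y Nodes.∈? S
      ... | yes y∈S = here (trans (cong (transpose x n) (only-x y∈S)) (transpose-left x n))
      ... | no  y∉S = there (subst (_∈ xs ∖ S) (sym (fixed y∉S y∈ n∉))
                              (∈-filter⁺ (Nodes._∉? S) y∈ y∉S))

      backward : ∀ {y} → y ∈ n ∷ (xs ∖ S) → transpose x n y ∈ xs
      backward (here refl) = subst (_∈ xs) (sym (transpose-right x n)) x∈
      backward (there y∈∖) = let y∈ , y∉S = ∈-filter⁻ (Nodes._∉? S) y∈∖ in
        subst (_∈ xs) (sym (fixed y∉S y∈ n∉)) y∈

    transposed-∉ : ∀ {xs} → x ∉ xs → n ∉ xs → xs ≋[ σ ] xs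
    transposed-∉ {xs} x∉ n∉ = ≋-intro σ unmoved unmoved
      where
      unmoved : ∀ {y} → y ∈ xs → transpose x n y ∈ xs
      unmoved y∈ = subst (_∈ xs) (sym (transpose-other (∈∧∉⇒≢ y∈ x∉) (∈∧∉⇒≢ y∈ n∉))) y∈

    -- Meant for the nodes of the type opposite to that of `x`: neither `x` nor `n` occurs there, so
    -- both the transposition and the removal of `S` change nothing.
    transposed-∖ : ∀ {xs} → x ∉ xs → n ∉ xs → xs ≋[ σ ] xs ∖ S
    transposed-∖ {xs} x∉ n∉ = mk≋ (mk⇔
      (λ y∈ → ∈-filter⁺ (Nodes._∉? S) (push e y∈)
                (λ σy∈S → x∉ (subst (_∈ xs) (only-x σy∈S) (push e y∈))))
      (λ y∈ → pull e (proj₁ (∈-filter⁻ (Nodes._∉? S) y∈))))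
      where
      e : xs ≋[ σ ] xs
      e = transposed-∉ x∉ n∉

    transposed-replace : ∀ {xs} → n ∉ xs →
      xs ≋[ σ ] (if does (any? (Nodes._∈? xs) S) then n ∷ (xs ∖ S) else xs)
    transposed-replace {xs} n∉ with any? (Nodes._∈? xs) S
    ... | yes p = let _ , y∈S , y∈ = find p in transposed-∈ (subst (_∈ xs) (only-x y∈S) y∈) n∉
    ... | no ¬p = transposed-∉ (λ x∈ → ¬p (lose x∈S x∈)) n∉

  module _ {M : Net} (io : IsIONet M) (n∉ : n ∉ nodes M) where

    private
      open IsIONet io using (isPetriNet; I⊆nodes; O⊆nodes)
      open IsPetriNet isPetriNet using (disjoint; bipartite)
      module M = Net M

      noLoop : ∀ {a} → (a , a) ∉ M.F
      noLoop e = Sum.[ (λ (t , p) → disjoint (p , t)) , disjoint ] (bipartite e)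

      Iₛ Oₛ : List Node
      Iₛ = Net.I (M ⟦ S ⟧)
      Oₛ = Net.O (M ⟦ S ⟧)

      Iₛ⊆S : ∀ {y} → y ∈ Iₛ → y ∈ S
      Iₛ⊆S y∈ = Sum.[ proj₂ ∘ ∈-filter⁻ _ {xs = M.I} , proj₁ ∘ ∈-filter⁻ _ ] (∈-++⁻ (M.I ∩ S) y∈)

      Oₛ⊆S : ∀ {y} → y ∈ Oₛ → y ∈ S
      Oₛ⊆S y∈ = Sum.[ proj₂ ∘ ∈-filter⁻ _ {xs = M.O} , proj₁ ∘ ∈-filter⁻ _ ] (∈-++⁻ (M.O ∩ S) y∈)

      kept? : Decidable (λ (e : Edge) → proj₁ e ∉ S × proj₂ e ∉ S)
      kept? e = (proj₁ e Nodes.∉? S) ×-dec (proj₂ e Nodes.∉? S)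

      entering? : Decidable (λ (e : Edge) → proj₁ e ∉ S × proj₂ e ∈ Iₛ)
      entering? e = (proj₁ e Nodes.∉? S) ×-dec (proj₂ e Nodes.∈? Iₛ)

      leaving? : Decidable (λ (e : Edge) → proj₁ e ∈ Oₛ × proj₂ e ∉ S)
      leaving? e = (proj₁ e Nodes.∈? Oₛ) ×-dec (proj₂ e Nodes.∉? S)

      Kept Entering Leaving : List Edge
      Kept     = filter kept? M.F
      Entering = map (λ e → proj₁ e , n) (filter entering? M.F)
      Leaving  = map (λ e → n , proj₂ e) (filter leaving? M.F)

      module _ (τ : NodeType) where

        F′ : List Edge
        F′ = Net.F (contract τ M S n)

        forward : ∀ {a b} → (a , b) ∈ M.F → (transpose x n a , transpose x n b) ∈ F′
        forward {a} {b} e = go (a Nodes.∈? S) (b Nodes.∈? S)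
          where
          a∈ : a ∈ nodes M
          a∈ = proj₁ (edge⇒nodes isPetriNet e)

          b∈ : b ∈ nodes M
          b∈ = proj₂ (edge⇒nodes isPetriNet e)

          moved : ∀ {y} → y ∈ S → transpose x n y ≡ n
          moved y∈S = trans (cong (transpose x n) (only-x y∈S)) (transpose-left x n)

          relabel : ∀ {a′ b′} → transpose x n a ≡ a′ → transpose x n b ≡ b′ →
                    (a′ , b′) ∈ F′ → (transpose x n a , transpose x n b) ∈ F′
          relabel p q = subst (_∈ F′) (cong₂ _,_ (sym p) (sym q))

          go : Dec (a ∈ S) → Dec (b ∈ S) → (transpose x n a , transpose x n b) ∈ F′
          -- Contraction drops the edges inside `S`. Here such an edge would be a loop at `x`,
          -- excluded because edges join a place and a transition.
          go (yes a∈S) (yes b∈S) =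
            ⊥-elim (noLoop (subst₂ (λ a b → (a , b) ∈ M.F) (only-x a∈S) (only-x b∈S) e))
          go (yes a∈S) (no b∉S)  = relabel (moved a∈S) (fixed b∉S b∈ n∉)
            (∈-++⁺ʳ Kept (∈-++⁺ʳ Entering (∈-map⁺ (λ e → n , proj₂ e) (∈-filter⁺ leaving? e (a∈Oₛ , b∉S)))))
            where
            a∈Oₛ : a ∈ Oₛ
            -- The edge `e`, leaving `S` at `a`, is itself the witness that makes `a` an output of
            -- the subnet.
            a∈Oₛ = ∈-++⁺ʳ (M.O ∩ S) (∈-filter⁺ _ a∈S (lose (∈-filter⁺ _ b∈ b∉S) e))
          go (no a∉S)  (yes b∈S) = relabel (fixed a∉S a∈ n∉) (moved b∈S)
            (∈-++⁺ʳ Kept (∈-++⁺ˡ (∈-map⁺ (λ e → proj₁ e , n) (∈-filter⁺ entering? e (a∉S , b∈Iₛ)))))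
            where
            b∈Iₛ : b ∈ Iₛ
            b∈Iₛ = ∈-++⁺ʳ (M.I ∩ S) (∈-filter⁺ _ b∈S (lose (∈-filter⁺ _ a∈ a∉S) e))
          go (no a∉S)  (no b∉S)  = relabel (fixed a∉S a∈ n∉) (fixed b∉S b∈ n∉)
            (∈-++⁺ˡ (∈-filter⁺ kept? e (a∉S , b∉S)))

        backward : ∀ {a b} → (a , b) ∈ F′ → (transpose x n a , transpose x n b) ∈ M.F
        backward ab∈ = Sum.[ kept , Sum.[ entering , leaving ] ∘ ∈-++⁻ Entering ] (∈-++⁻ Kept ab∈)
          where
          returned : ∀ {y} → y ∈ S → transpose x n n ≡ y
          returned y∈S = trans (transpose-right x n) (sym (only-x y∈S))

          relabel : ∀ a b {a′ b′} → transpose x n a ≡ a′ → transpose x n b ≡ b′ →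
                    (a′ , b′) ∈ M.F → (transpose x n a , transpose x n b) ∈ M.F
          relabel _ _ p q = subst (_∈ M.F) (cong₂ _,_ (sym p) (sym q))

          kept : ∀ {a b} → (a , b) ∈ Kept → (transpose x n a , transpose x n b) ∈ M.F
          kept {a} {b} ab∈ =
            let e , a∉S , b∉S = ∈-filter⁻ kept? ab∈
                a∈ , b∈ = edge⇒nodes isPetriNet e
            in relabel a b (fixed a∉S a∈ n∉) (fixed b∉S b∈ n∉) e

          entering : ∀ {a b} → (a , b) ∈ Entering →
                     (transpose x n a , transpose x n b) ∈ M.F
          entering ab∈ with ∈-map⁻ (λ e → proj₁ e , n) ab∈
          ... | (a , _) , e∈ , refl =
            let e , a∉S , b∈Iₛ = ∈-filter⁻ entering? e∈
                a∈ , _ = edge⇒nodes isPetriNet e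
            in relabel a n (fixed a∉S a∈ n∉) (returned (Iₛ⊆S b∈Iₛ)) e

          leaving : ∀ {a b} → (a , b) ∈ Leaving →
                    (transpose x n a , transpose x n b) ∈ M.F
          leaving ab∈ with ∈-map⁻ (λ e → n , proj₂ e) ab∈
          ... | (_ , b) , e∈ , refl =
            let e , a∈Oₛ , b∉S = ∈-filter⁻ leaving? e∈
                _ , b∈ = edge⇒nodes isPetriNet e
            in relabel n b (returned (Oₛ⊆S a∈Oₛ)) (fixed b∉S b∈ n∉) e

      -- The subnet has some input; it has type `τ` and lies in `S`, so it is `x`. Thus the new node
      -- has the type of the node that it replaces.
      x∈type : ∀ τ → IsτWF τ (M ⟦ S ⟧) → x ∈ nodesOfType τ M
      x∈type τ (wf , within) with Iₛ in eq
      ... | []     = ⊥-elim (IsIONet.I≢∅ (IsWF.isIONet wf) eq)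
      ... | y ∷ ys = go τ (within (here refl))
        where
        go : ∀ τ → y ∈ nodesOfType τ (M ⟦ S ⟧) → x ∈ nodesOfType τ M
        go place      y∈ = let y∈P , y∈S = ∈-filter⁻ (Nodes._∈? S) y∈ in subst (_∈ M.P) (only-x y∈S) y∈P
        go transition y∈ = let y∈T , y∈S = ∈-filter⁻ (Nodes._∈? S) y∈ in subst (_∈ M.T) (only-x y∈S) y∈T

    -- The fresh `n` takes over the type of `x` by `x∈type`, and all of its edges: without loops,
    -- every edge at `x` enters or leaves `S`.
    singleton-contract-≅ : ∀ τ → IsτWF τ (M ⟦ S ⟧) → M ≅[ transposition x n ] contract τ M S n
    singleton-contract-≅ τ wf = record
      { P-≋ = P′ τ (x∈type τ wf)
      ; T-≋ = T′ τ (x∈type τ wf)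
      ; F-≋ = ≋-intro (edges σ) (forward τ) (backward τ)
      ; I-≋ = transposed-replace (n∉ ∘ I⊆nodes)
      ; O-≋ = transposed-replace (n∉ ∘ O⊆nodes)
      }
      where
      P′ : ∀ τ → x ∈ nodesOfType τ M → M.P ≋[ σ ] Net.P (contract τ M S n)
      P′ place      x∈P = transposed-∈ x∈P (n∉ ∘ ∈-++⁺ˡ)
      P′ transition x∈T = transposed-∖ (λ x∈P → disjoint (x∈P , x∈T)) (n∉ ∘ ∈-++⁺ˡ)

      T′ : ∀ τ → x ∈ nodesOfType τ M → M.T ≋[ σ ] Net.T (contract τ M S n)
      T′ place      x∈P = transposed-∖ (λ x∈T → disjoint (x∈P , x∈T)) (n∉ ∘ ∈-++⁺ʳ M.P)
      T′ transition x∈T = transposed-∈ x∈T (n∉ ∘ ∈-++⁺ʳ M.P)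

-- Isomorphism of WF nets and equality of classes.

infix 4 _≃_

-- A record, so that M and N are recovered by unification.
record _≃_ (M N : WFNet) : Set where
  constructor mk≃
  field
    relabelling : Node ↔ Node
    relabels   : net M ≅[ relabelling ] net N

≃-refl : ∀ {M} → M ≃ M
≃-refl = mk≃ ↔-refl (≈⇒≅ ≈-refl)

≃-sym : ∀ {M N} → M ≃ N → N ≃ M
≃-sym (mk≃ π φ) = mk≃ (↔-sym π) (≅-sym π φ)

≃-trans : ∀ {L M N} → L ≃ M → M ≃ N → L ≃ N
≃-trans (mk≃ π φ) (mk≃ ρ ψ) = mk≃ (↔-trans π ρ) (≅-trans π ρ φ ψ)

≃⇒~ : ∀ {M N} → M ≃ N → M ~ N
≃⇒~ (mk≃ π φ) = record
  { h         = π ⟨$⟩ʳ_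
  ; injective = λ _ _ → ↔-injective π
  ; P-image   = set-map-≋ π (P-≋ φ)
  ; T-image   = set-map-≋ π (T-≋ φ)
  ; F-image   = set-map-≋ (edges π) (F-≋ φ)
  ; I-image   = set-map-≋ π (I-≋ φ)
  ; O-image   = set-map-≋ π (O-≋ φ)
  }

-- The components of a WF net mention only nodes and pairs of nodes, and there the permutation
-- extending `h` agrees with `h`.
~⇒≃ : ∀ {M N} → M ~ N → M ≃ N
~⇒≃ {M} iso with extendToPermutation (_~_.h iso) (nodes (net M)) (_~_.injective iso)
... | π , π≗h = mk≃ π record
  { P-≋ = image-≋ π (π≗h ∘ ∈-++⁺ˡ) P-image
  ; T-≋ = image-≋ π (π≗h ∘ ∈-++⁺ʳ _) T-image
  ; F-≋ = image-≋ (edges π) (λ e → let a∈ , b∈ = edge⇒nodes isPetriNet e in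
            cong₂ _,_ (π≗h a∈) (π≗h b∈)) F-image
  ; I-≋ = image-≋ π (π≗h ∘ I⊆nodes) I-image
  ; O-≋ = image-≋ π (π≗h ∘ O⊆nodes) O-image
  }
  where
  open _~_ iso
  open IsIONet (IsWF.isIONet (isWF M))

≃⇒≐ : ∀ {M N} → M ≃ N → [ M ] ≐ [ N ]
≃⇒≐ e = (λ M~L → ≃⇒~ (≃-trans (≃-sym e) (~⇒≃ M~L))) , (λ N~L → ≃⇒~ (≃-trans e (~⇒≃ N~L)))

-- `N` lies in its own class, hence in that of `M`.
≐⇒≃ : ∀ {M N} → [ M ] ≐ [ N ] → M ≃ N
≐⇒≃ {N = N} (_ , [N]⊆[M]) = ~⇒≃ ([N]⊆[M] (≃⇒~ (≃-refl {N})))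

∣nodes∣-≃ : ∀ {M N} → M ≃ N → ∣ nodes (net M) ∣ ≡ ∣ nodes (net N) ∣
∣nodes∣-≃ (mk≃ π φ) = ∣∣-≋ π (nodes-≋ φ)

IsOneNode-≃ : ∀ {M N} → M ≃ N → IsOneNode M → IsOneNode N
IsOneNode-≃ e one = trans (sym (∣nodes∣-≃ e)) one

-- Contractions along isomorphisms.

Contraction : WFNet → List Node → WFNet → Set
Contraction M S M′ = ANDORContractible M S × ContractsTo (net M) S (net M′)

-- The relabelling carries `S` to its image and, being a permutation of all names, also carries the
-- fresh `n` to a name fresh for `N`. The contracted net is well-formed because it is isomorphic to
-- `M′`. The equality of sizes lets triviality of the subnet be carried over.
contraction-≃ : ∀ {M N S M′} → M ≃ N → Contraction M S M′ →
  ∃₂ λ S′ N′ → ∣ S′ ∣ ≡ ∣ S ∣ × Contraction N S′ N′ × M′ ≃ N′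
contraction-≃ {M} {N} {S} {M′} (mk≃ π φ) (contractible , τ , n , τWF , n∉ , M′≈) =
  S′ , N′ , sym (∣∣-≋ π σ) ,
  ( record
    { isSubnet   = IsSubnet-≅ π⁻¹ ψ σ⁻¹ isSubnet
    ; wellNested = WellNested-≅ π⁻¹ ψ σ⁻¹ wellNested
    ; basic      = BasicANDOR-≅ π⁻¹ (subnet-≅ π⁻¹ ψ σ⁻¹) basic
    }
  , τ , π ⟨$⟩ʳ n , IsτWF-≅ π⁻¹ (subnet-≅ π⁻¹ ψ σ⁻¹) τ τWF , n∉ ∘ pull (nodes-≋ φ) , ≈-refl
  ) , mk≃ ρ χ
  where
  open ANDORContractible contractible

  S′ : List Node
  S′ = map (π ⟨$⟩ʳ_) S

  σ : S ≋[ π ] S′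
  σ = ≋-map π

  π⁻¹ : Node ↔ Node
  π⁻¹ = ↔-sym π

  σ⁻¹ : S′ ≋[ π⁻¹ ] S
  σ⁻¹ = ≋-sym π σ

  ψ : net N ≅[ π⁻¹ ] net M
  ψ = ≅-sym π φ

  ρ : Node ↔ Node
  ρ = ↔-trans ↔-refl π

  χ : net M′ ≅[ ρ ] contract τ (net N) S′ (π ⟨$⟩ʳ n)
  χ = ≅-trans ↔-refl π (≈⇒≅ M′≈) (contract-≅ π φ σ τ n)

  N′ : WFNet
  N′ = record
    { net  = contract τ (net N) S′ (π ⟨$⟩ʳ n)
    ; isWF = IsWF-≅ (↔-sym ρ) (≅-sym ρ χ) (isWF M′)
    }

trivialContraction-≃ : ∀ {M S M′} → IsTrivial S → ContractsTo (net M) S (net M′) → M ≃ M′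
trivialContraction-≃ {M} {M′ = M′} trivial (τ , n , τWF , n∉ , M′≈) =
  let x , x∈S , only-x = ∣∣≡1⇒singleton trivial
      σ = transposition x n
  in mk≃ (↔-trans σ (↔-sym ↔-refl))
       (≅-trans σ (↔-sym ↔-refl)
         (singleton-contract-≅ x∈S only-x (IsWF.isIONet (isWF M)) n∉ τ τWF)
         (≅-sym ↔-refl (≈⇒≅ M′≈)))

-- Node counts of contractions.

nodes-contract : ∀ τ M S n → nodes (contract τ M S n) ≋[ ↔-refl ] n ∷ (nodes M ∖ S)
nodes-contract place M S n
  rewrite filter-++ (Nodes._∉? S) (Net.P M) (Net.T M) = mk≋ (mk⇔ id id)
-- A new transition is listed behind the places; `shift` brings it to the front.
nodes-contract transition M S n
  rewrite filter-++ (Nodes._∉? S) (Net.P M) (Net.T M) =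
  mk≋ (mk⇔ (∈-resp-↭ p) (∈-resp-↭ (↭-sym p)))
  where p = shift n (Net.P M ∖ S) (Net.T M ∖ S)

-- The nodes of `S` go and one fresh node comes; the additive form avoids truncated subtraction.
∣nodes∣-contraction : ∀ {M S M′} → IsSubnet M S → ContractsTo M S M′ →
                      ∣ nodes M′ ∣ + ∣ S ∣ ≡ suc ∣ nodes M ∣
∣nodes∣-contraction {M} {S} {M′} sub (τ , n , _ , n∉ , M′≈) = begin
  ∣ nodes M′ ∣ + ∣ S ∣                  ≡⟨ cong (_+ ∣ S ∣) (∣∣-≋ ↔-refl (nodes-≋ (≈⇒≅ M′≈))) ⟩
  ∣ nodes (contract τ M S n) ∣ + ∣ S ∣  ≡⟨ cong (_+ ∣ S ∣) (∣∣-≋ ↔-refl (nodes-contract τ M S n)) ⟩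
  ∣ n ∷ (nodes M ∖ S) ∣ + ∣ S ∣         ≡⟨ cong (_+ ∣ S ∣) (∣∷∣ (n∉ ∘ proj₁ ∘ ∈-filter⁻ (Nodes._∉? S))) ⟩
  suc (∣ nodes M ∖ S ∣ + ∣ S ∣)         ≡⟨ cong suc (∣∖∣+∣∣ (IsSubnet.S⊆nodes sub)) ⟩
  suc ∣ nodes M ∣                       ∎
  where open ≡-Reasoning

-- Equal node counts on both sides force `∣ S ∣` to be 1. By contraposition a non-trivial
-- contraction leaves the isomorphism class, as `_⇒_` demands.
contraction-≃⇒trivial : ∀ {M S M′} → Contraction M S M′ → M ≃ M′ → IsTrivial S
contraction-≃⇒trivial {M} {S} {M′} (contractible , contracts) e =
  +-cancelˡ-≡ ∣ nodes (net M) ∣ ∣ S ∣ 1 (begin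
    ∣ nodes (net M) ∣ + ∣ S ∣   ≡⟨ cong (_+ ∣ S ∣) (∣nodes∣-≃ e) ⟩
    ∣ nodes (net M′) ∣ + ∣ S ∣  ≡⟨ ∣nodes∣-contraction (ANDORContractible.isSubnet contractible) contracts ⟩
    suc ∣ nodes (net M) ∣       ≡⟨ +-comm 1 _ ⟩
    ∣ nodes (net M) ∣ + 1       ∎)
  where open ≡-Reasoning

-- By `∣∖∣+∣∣` the number 1 splits as `∣ nodes M ∖ S ∣ + ∣ S ∣`, and the second summand is not zero.
oneNode⇒trivial : ∀ {M S} → ∣ nodes M ∣ ≡ 1 → IsSubnet M S → IsTrivial S
oneNode⇒trivial {M} {S} one sub
  with ∣ nodes M ∖ S ∣ | ∣ S ∣ in eq | trans (∣∖∣+∣∣ (IsSubnet.S⊆nodes sub)) one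
... | 0     | _     | p = p
... | suc _ | 0     | _ = contradiction eq (≢[]⇒∣∣≢0 (IsSubnet.nonEmpty sub))
... | suc m | suc k | p with () ← trans (sym (+-suc m k)) (suc-injective p)

-- Translations between the three reductions.

-- Induction on the sequence with an isomorphic copy `N` alongside: a trivial contraction only
-- changes the isomorphism and leaves `N` in place, a non-trivial one is replayed in `N`.
⇝*⇒⇝ⁿᵗ* : ∀ {M M′ N} → M ⇝* M′ → M ≃ N → ∃[ N′ ] Star _⇝ⁿᵗ_ N N′ × M′ ≃ N′
⇝*⇒⇝ⁿᵗ* ε e = _ , ε , e
⇝*⇒⇝ⁿᵗ* ((S , c) ◅ rest) e with ∣ S ∣ ≟ 1
... | yes trivial =
  ⇝*⇒⇝ⁿᵗ* rest (≃-trans (≃-sym (trivialContraction-≃ trivial (proj₂ c))) e)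
... | no nontrivial =
  let S′ , _ , eq , c′ , e₁ = contraction-≃ e c
      N′ , steps , e′ = ⇝*⇒⇝ⁿᵗ* rest e₁
  in N′ , (S′ , nontrivial ∘ trans (sym eq) , c′) ◅ steps , e′

-- Lets a trivial contraction be absorbed at the start of a class-based reduction, which depends on
-- the class of its first net only.
≃-⇒* : ∀ {L M N} → L ≃ M → M ⇒* N → L ⇒* N
≃-⇒* e (done M≐N) = done (≃⇒≐ (≃-trans e (≐⇒≃ M≐N)))
≃-⇒* e (step (M≭M′ , M₁ , M₂ , M~M₁ , M′~M₂ , c) rest) = step
  ( (λ L≐M′ → M≭M′ (≃⇒≐ (≃-trans (≃-sym e) (≐⇒≃ L≐M′))))
  , M₁ , M₂ , ≃⇒~ (≃-trans e (~⇒≃ M~M₁)) , M′~M₂ , c) rest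

⇝*⇒⇒* : ∀ {M M′} → M ⇝* M′ → M ⇒* M′
⇝*⇒⇒* {M} ε = done (≃⇒≐ (≃-refl {M}))
⇝*⇒⇒* {M} (_◅_ {j = M₁} (S , c) rest) with ∣ S ∣ ≟ 1
... | yes trivial    = ≃-⇒* (trivialContraction-≃ trivial (proj₂ c)) (⇝*⇒⇒* rest)
... | no  nontrivial = step
  ( (λ M≐M₁ → nontrivial (contraction-≃⇒trivial {M} {M′ = M₁} c (≐⇒≃ M≐M₁)))
  , M , M₁ , ≃⇒~ (≃-refl {M}) , ≃⇒~ (≃-refl {M₁}) , S , c) (⇝*⇒⇒* rest)

-- A class step is witnessed by a contraction between some representatives; transported to the
-- current net `N`, these contractions join into one actual sequence.
⇒*⇒⇝* : ∀ {M M′ N} → M ⇒* M′ → M ≃ N → ∃[ N′ ] N ⇝* N′ × M′ ≃ N′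
⇒*⇒⇝* {M} {M′} {N} (done M≐M′) e = N , ε , ≃-trans (≃-sym (≐⇒≃ M≐M′)) e
⇒*⇒⇝* (step (_ , _ , _ , M~M₁ , M′~M₂ , S , c) rest) e =
  let S′ , _ , _ , c′ , e₂ = contraction-≃ (≃-trans (≃-sym (~⇒≃ M~M₁)) e) c
      N′ , steps , e′ = ⇒*⇒⇝* rest (≃-trans (~⇒≃ M′~M₂) e₂)
  in N′ , (S′ , c′) ◅ steps , e′

-- Any contraction of a one-node representative is trivial and so stays in the class, whereas `_⇒_`
-- requires distinct classes.
oneNode⇒⇒-normal : ∀ {M} → IsOneNode M → ¬ (∃[ M′ ] M ⇒ M′)
oneNode⇒⇒-normal one (_ , M≭M′ , _ , _ , M~M₁ , M′~M₂ , _ , contractible , contracts) =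
  M≭M′ (≃⇒≐ (≃-trans (~⇒≃ M~M₁) (≃-trans (trivialContraction-≃ trivial contracts) (≃-sym (~⇒≃ M′~M₂)))))
  where
  trivial = oneNode⇒trivial (IsOneNode-≃ (~⇒≃ M~M₁) one) (ANDORContractible.isSubnet contractible)

NetReducible ClassReducible ANDORReducible : WFNet → Set
NetReducible   M = ∃[ M′ ] NetBasedResult M M′ × IsOneNode M′
ClassReducible M = ∃[ M′ ] ClassBasedResult M M′ × [ M′ ] ⊆ IsOneNode
ANDORReducible M = ∃[ M′ ] M ⇝* M′ × IsOneNode M′

net⇒ANDOR : ∀ {M} → NetReducible M → ANDORReducible M
net⇒ANDOR (M′ , (steps , _) , one) =
  M′ , gmap id (λ (S , _ , c) → S , c) steps , one

ANDOR⇒net : ∀ {M} → ANDORReducible M → NetReducible M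
ANDOR⇒net {M} (_ , steps , one) =
  let M′ , steps′ , e = ⇝*⇒⇝ⁿᵗ* steps (≃-refl {M})
      one′ = IsOneNode-≃ e one
  in M′ , (steps′ , λ (_ , nontrivial , c) →
       nontrivial (oneNode⇒trivial one′ (ANDORContractible.isSubnet c))) , one′

class⇒ANDOR : ∀ {M} → ClassReducible M → ANDORReducible M
class⇒ANDOR {M} (M₁ , (steps , _) , one) =
  let M′ , steps′ , e = ⇒*⇒⇝* steps (≃-refl {M})
  -- The net reached may differ from `M₁`, but it belongs to the class of `M₁`, all of whose members
  -- have one node.
  in M′ , steps′ , one (≃⇒~ e)

ANDOR⇒class : ∀ {M} → ANDORReducible M → ClassReducible M
ANDOR⇒class (M′ , steps , one) =
  M′ , (⇝*⇒⇒* steps , oneNode⇒⇒-normal one) , λ M′~N → IsOneNode-≃ (~⇒≃ M′~N) one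

theorem66 : (M : WFNet) →
    ((∃[ M′ ] NetBasedResult M M′ × IsOneNode M′) ⇔ (∃[ M′ ] ClassBasedResult M M′ × [ M′ ] ⊆ IsOneNode))
    × ((∃[ M′ ] ClassBasedResult M M′ × [ M′ ] ⊆ IsOneNode) ⇔ (∃[ M′ ] M ⇝* M′ × IsOneNode M′))
theorem66 M =
  -- Plain AND-OR reducibility, statement (iii), is the hub through which (i) and (ii) are compared.
  mk⇔ (ANDOR⇒class ∘ net⇒ANDOR) (ANDOR⇒net ∘ class⇒ANDOR) , mk⇔ class⇒ANDOR ANDOR⇒class
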